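{- If $c:(\vdash\Gamma)$ is derivable in the type system $\mathrm{MAL}\omega$, then the command $c$ normalizes for $\to_0\,=\,\to_\beta\cup\to_\mu$ using at most $|c|$ $\to_\beta$-steps, where $|c|$ is the size of $c$.
   Context: **Terms.** There are positive variables $x,y,\dots$ and negative variables $\alpha,\beta,\dots$; $\kappa,\kappa'$ denote variables of either polarity. The syntax may contain constants $k_+\in\mathcal K_+$, $k_-\in\mathcal K_-$ (which have no typing rule). Grammar: positive values $V_+::=x\mid (V,V')\mid\{V\}\mid k_+$; values $V::=V_+\mid t_-$; positive terms $t_+::=V_+\mid\mu\alpha.c$; negative terms $t_-::=\alpha\mid\mu(\kappa,\kappa').c\ (\kappa\ne\kappa')\mid\mu\{\kappa\}.c\mid\mu x.c\mid k_-$; commands $c::=\langle t_+|t_-\rangle$, where $\langle t|u\rangle$ and $\langle u|t\rangle$ are identified. Everything is up to $\alpha$-equivalence. $|c|$ is the size (number of symbols) of $c$. **Reduction** (on whole commands, not under binders): $\langle\mu\alpha.c|t_-\rangle\to_\mu c[t_-/\alpha]$; $\langle V_+|\mu x.c\rangle\to_\mu c[V_+/x]$; $\langle\{V\}|\mu\{\kappa\}.c\rangle\to_\beta c[V/\kappa]$; $\langle(V,V')|\mu(\kappa,\kappa').c\rangle\to_\beta c[V/\kappa,V'/\kappa']$ (the $\to_\beta$ rules only if polarities of variables and values match). **Kinds and constructors.** Kinds: $\sigma,\tau::=\iota\mid o^+\mid o^-\mid\sigma\to\tau$. Constructors: $T,U,A,B::=x^\tau\mid(x^\tau)^\bot\mid\lambda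 x^\tau.T\mid TU\mid\mathbf 0\mid\mathbf s\mid rec_\tau\mid rec_\tau^\bot\mid A\otimes B\mid A\wp B\mid\exists x^\tau.A\mid\forall x^\tau.A\mid\downarrow A\mid\uparrow A$. Binders bind both $x^\tau$ and $(x^\tau)^\bot$; substituting $U$ for $x^\tau$ replaces $(x^\tau)^\bot$ by $U^\bot$. Negation on kinds: $(o^+)^\bot=o^-$, $(o^-)^\bot=o^+$, $\iota^\bot=\iota$, $(\sigma\to\tau)^\bot=\sigma\to\tau^\bot$. Involutive negation on constructors: it exchanges $x^\tau$ and $(x^\tau)^\bot$, $rec_\tau$ and $rec_\tau^\bot$; $\mathbf 0^\bot=\mathbf 0$, $\mathbf s^\bot=\mathbf s$, $(\lambda x.T)^\bot=\lambda x.T^\bot$, $(TU)^\bot=T^\bot U$, $(A\otimes B)^\bot=A^\bot\wp B^\bot$, $(A\wp B)^\bot=A^\bot\otimes B^\bot$, $(\forall x.A)^\bot=\exists x.A^\bot$, $(\exists x.A)^\bot=\forall x.A^\bot$, $(\uparrow A)^\bot=\downarrow A^\bot$, $(\downarrow A)^\bot=\uparrow A^\bot$. Kinding: $x^\tau:\tau$; $(x^\tau)^\bot:\tau^\bot$; $\lambda x^\sigma.T:\sigma\to\tau$ if $T:\tau$; $TU:\tau$ if $T:\sigma\to\tau,U:\sigma$; $\mathbf 0:\iota$; $\mathbf s:\iota\to\iota$; $rec_\tau:\tau\to(\iota\to\tau\to\tau)\to\iota\to\tau$; $rec_\tau^\bot:\tau\to(\iota\to\tau\to\tau)\to\iota\to\tau^\bot$;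 for $A,B$ of kind $o^+$ or $o^-$: $A\otimes B:o^+$, $\downarrow A:o^+$, $A\wp B:o^-$, $\uparrow A:o^-$; $\forall x^\tau.A$ and $\exists x^\tau.A$ have the same kind $o^{+}$ or $o^-$ as $A$. Formulas are constructors of kind $o^+$ (positive, $P$) or $o^-$ (negative, $N$). Convertibility $\cong$ is the least equivalence relation containing $(\lambda x.T)U\cong T\{x:=U\}$; $\lambda x.Tx\cong T$ ($x$ not free in $T$); $rec_\tau T U\mathbf 0\cong T$; $rec_\tau TU(\mathbf s n)\cong U n(rec_\tau TUn)$; $rec_\tau^\bot TU\mathbf 0\cong T^\bot$; $rec_\tau^\bot TU(\mathbf sn)\cong U^\bot n(rec_\tau TUn)$; and closed under $\lambda$, application, $\otimes$, $\wp$, $\exists$, $\forall$. **Typing rules of $\mathrm{MAL}\omega$.** Contexts $\Gamma,\Delta$ are finite sets of declarations $x:N$ (positive variable, negative formula) or $\alpha:P$ (negative variable, positive formula). Judgments: $\vdash t_+:P\mid\Gamma$, $\vdash t_-:N\mid\Gamma$, $c:(\vdash\Gamma)$. Rules (premises $\Rightarrow$ conclusion): $(Ax_+)$ $\vdash x:P\mid x:P^\bot$; $(Ax_-)$ $\vdash\alpha:N\mid\alpha:N^\bot$; $(\mu_+)$ $c:(\vdash\alpha:P,\Gamma)\Rightarrow\ \vdash\mu\alpha.c:P\mid\Gamma$; $(\mu_-)$ $c:(\vdash x:N,\Gamma)\Rightarrow\ \vdash\mu x.c:N\mid\Gamma$; $(Cut)$ $\vdash t:A\mid\Gamma$ and $\vdash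 u:A^\bot\mid\Delta\Rightarrow\langle t|u\rangle:(\vdash\Gamma,\Delta)$; $(\otimes)$ $\vdash V:A\mid\Gamma$ and $\vdash V':B\mid\Delta\Rightarrow\ \vdash(V,V'):A\otimes B\mid\Gamma,\Delta$; $(\wp)$ $c:(\vdash\kappa:A,\kappa':B,\Gamma)\Rightarrow\ \vdash\mu(\kappa,\kappa').c:A\wp B\mid\Gamma$; $(\downarrow)$ $\vdash V:A\mid\Gamma\Rightarrow\ \vdash\{V\}:\downarrow A\mid\Gamma$; $(\uparrow)$ $c:(\vdash\kappa:A,\Gamma)\Rightarrow\ \vdash\mu\{\kappa\}.c:\uparrow A\mid\Gamma$; $(\exists)$ $\vdash t:A[T/x^\tau]\mid\Gamma$ with $T:\tau\Rightarrow\ \vdash t:\exists x^\tau.A\mid\Gamma$; $(\forall)$ $\vdash V:A\mid\Gamma$ with $x^\tau$ not in $\Gamma\Rightarrow\ \vdash V:\forall x^\tau.A\mid\Gamma$; $(\cong)$ $c:(\vdash\kappa:A,\Gamma)$ with $A\cong B\Rightarrow c:(\vdash\kappa:B,\Gamma)$; $(W)$ $c:(\vdash\Gamma)\Rightarrow c:(\vdash\kappa:A,\Gamma)$. In two-premise rules $\Gamma$ and $\Delta$ are disjoint (so every typable term is affine: each bound variable occurs at most once). -}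

module Defs where

open import Data.List.Base using (List; []; _∷_)
open import Data.List.Membership.Propositional using (_∈_)
open import Data.List.Relation.Binary.Subset.Propositional using (_⊆_)
open import Data.List.Relation.Unary.All as All using (All; []; _∷_; lookup; _[_]≔_)
open import Data.List.Relation.Unary.Any using (here; there)
open import Data.Maybe.Base as Maybe using (Maybe; just; nothing)
open import Data.Nat.Base using (ℕ; suc; _+_; _≤_)
open import Data.Product.Base using (∃-syntax; Σ-syntax; _×_)
open import Data.Sign.Base public using (opposite) renaming (Sign to Polarity; + to ⊕; - to ⊖)
open import Data.Sum.Base using (inj₁; inj₂)
open import Relation.Binary.Construct.Closure.ReflexiveTransitive using (Star; ε; _◅_)
open import Relation.Binary.Construct.Union using (_∪_)
open import Relation.Binary.PropositionalEquality.Core using (_≡_; refl)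
open import Relation.Binary.Rewriting using (IsNormalForm)

infixr 7 _⇒_

data Kind : Set where
  ι   : Kind
  o   : Polarity → Kind
  _⇒_ : Kind → Kind → Kind

infix 30 _⊥ᵏ _⊥

_⊥ᵏ : Kind → Kind
ι ⊥ᵏ       = ι
(o p) ⊥ᵏ   = o (opposite p)
(σ ⇒ τ) ⊥ᵏ = σ ⇒ τ ⊥ᵏ

-- All syntax is well-scoped de Bruijn, so α-equivalence is equality.

infixl 20 _·_
infixr 15 _⊗_ _⅋_

-- Raw, possibly ill-kinded, constructors whose free variables are drawn
-- from Ξ.  A variable x^τ is a position of τ in Ξ; covar is (x^τ)⊥.
data Con (Ξ : List Kind) : Set where
  var covar : ∀ {τ} → τ ∈ Ξ → Con Ξ
  ƛ         : ∀ τ → Con (τ ∷ Ξ) → Con Ξ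
  _·_       : Con Ξ → Con Ξ → Con Ξ
  𝟎 𝐬       : Con Ξ
  rec rec⊥  : Kind → Con Ξ
  _⊗_ _⅋_   : Con Ξ → Con Ξ → Con Ξ
  ∃ᶜ ∀ᶜ     : ∀ τ → Con (τ ∷ Ξ) → Con Ξ
  ↓ ↑       : Con Ξ → Con Ξ

_⊥ : ∀ {Ξ} → Con Ξ → Con Ξ
(var x) ⊥   = covar x
(covar x) ⊥ = var x
(ƛ τ T) ⊥   = ƛ τ (T ⊥)
(T · U) ⊥   = T ⊥ · U
𝟎 ⊥         = 𝟎
𝐬 ⊥         = 𝐬
(rec τ) ⊥   = rec⊥ τ
(rec⊥ τ) ⊥  = rec τ
(A ⊗ B) ⊥   = A ⊥ ⅋ B ⊥
(A ⅋ B) ⊥   = A ⊥ ⊗ B ⊥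
(∃ᶜ τ A) ⊥  = ∀ᶜ τ (A ⊥)
(∀ᶜ τ A) ⊥  = ∃ᶜ τ (A ⊥)
(↓ A) ⊥     = ↑ (A ⊥)
(↑ A) ⊥     = ↓ (A ⊥)

liftᴿ : ∀ {a} {A : Set a} {x : A} {xs ys : List A} → xs ⊆ ys → x ∷ xs ⊆ x ∷ ys
liftᴿ ρ (here refl) = here refl
liftᴿ ρ (there i)   = there (ρ i)

renᶜ : ∀ {Ξ Ξ′} → Ξ ⊆ Ξ′ → Con Ξ → Con Ξ′
renᶜ ρ (var x)   = var (ρ x)
renᶜ ρ (covar x) = covar (ρ x)
renᶜ ρ (ƛ τ T)   = ƛ τ (renᶜ (liftᴿ ρ) T)
renᶜ ρ (T · U)   = renᶜ ρ T · renᶜ ρ U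
renᶜ ρ 𝟎         = 𝟎
renᶜ ρ 𝐬         = 𝐬
renᶜ ρ (rec τ)   = rec τ
renᶜ ρ (rec⊥ τ)  = rec⊥ τ
renᶜ ρ (A ⊗ B)   = renᶜ ρ A ⊗ renᶜ ρ B
renᶜ ρ (A ⅋ B)   = renᶜ ρ A ⅋ renᶜ ρ B
renᶜ ρ (∃ᶜ τ A)  = ∃ᶜ τ (renᶜ (liftᴿ ρ) A)
renᶜ ρ (∀ᶜ τ A)  = ∀ᶜ τ (renᶜ (liftᴿ ρ) A)
renᶜ ρ (↓ A)     = ↓ (renᶜ ρ A)
renᶜ ρ (↑ A)     = ↑ (renᶜ ρ A)

wkᶜ : ∀ {Ξ σ} → Con Ξ → Con (σ ∷ Ξ)
wkᶜ = renᶜ there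

Subᶜ : List Kind → List Kind → Set
Subᶜ Ξ Ξ′ = ∀ {τ} → τ ∈ Ξ → Con Ξ′

liftᶜ : ∀ {Ξ Ξ′ σ} → Subᶜ Ξ Ξ′ → Subᶜ (σ ∷ Ξ) (σ ∷ Ξ′)
liftᶜ s (here refl) = var (here refl)
liftᶜ s (there x)   = wkᶜ (s x)

subᶜ : ∀ {Ξ Ξ′} → Subᶜ Ξ Ξ′ → Con Ξ → Con Ξ′
subᶜ s (var x)   = s x
subᶜ s (covar x) = s x ⊥
subᶜ s (ƛ τ T)   = ƛ τ (subᶜ (liftᶜ s) T)
subᶜ s (T · U)   = subᶜ s T · subᶜ s U
subᶜ s 𝟎         = 𝟎
subᶜ s 𝐬         = 𝐬
subᶜ s (rec τ)   = rec τ
subᶜ s (rec⊥ τ)  = rec⊥ τ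
subᶜ s (A ⊗ B)   = subᶜ s A ⊗ subᶜ s B
subᶜ s (A ⅋ B)   = subᶜ s A ⅋ subᶜ s B
subᶜ s (∃ᶜ τ A)  = ∃ᶜ τ (subᶜ (liftᶜ s) A)
subᶜ s (∀ᶜ τ A)  = ∀ᶜ τ (subᶜ (liftᶜ s) A)
subᶜ s (↓ A)     = ↓ (subᶜ s A)
subᶜ s (↑ A)     = ↑ (subᶜ s A)

infix 25 _[_]ᶜ

_[_]ᶜ : ∀ {Ξ σ} → Con (σ ∷ Ξ) → Con Ξ → Con Ξ
_[_]ᶜ {Ξ} {σ} T U = subᶜ s T
  where
  s : Subᶜ (σ ∷ Ξ) Ξ
  s (here refl) = U
  s (there x)   = var x

infix 4 _∶ᵏ_ _≅_

data _∶ᵏ_ {Ξ : List Kind} : Con Ξ → Kind → Set where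
  var   : ∀ {τ} (x : τ ∈ Ξ) → var x ∶ᵏ τ
  covar : ∀ {τ} (x : τ ∈ Ξ) → covar x ∶ᵏ τ ⊥ᵏ
  ƛ     : ∀ {σ τ T} → T ∶ᵏ τ → ƛ σ T ∶ᵏ σ ⇒ τ
  _·_   : ∀ {σ τ T U} → T ∶ᵏ σ ⇒ τ → U ∶ᵏ σ → T · U ∶ᵏ τ
  𝟎     : 𝟎 ∶ᵏ ι
  𝐬     : 𝐬 ∶ᵏ ι ⇒ ι
  rec   : ∀ τ → rec τ ∶ᵏ τ ⇒ (ι ⇒ τ ⇒ τ) ⇒ ι ⇒ τ
  rec⊥  : ∀ τ → rec⊥ τ ∶ᵏ τ ⇒ (ι ⇒ τ ⇒ τ) ⇒ ι ⇒ τ ⊥ᵏ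
  _⊗_   : ∀ {p q A B} → A ∶ᵏ o p → B ∶ᵏ o q → A ⊗ B ∶ᵏ o ⊕
  _⅋_   : ∀ {p q A B} → A ∶ᵏ o p → B ∶ᵏ o q → A ⅋ B ∶ᵏ o ⊖
  ∃ᶜ    : ∀ {τ p A} → A ∶ᵏ o p → ∃ᶜ τ A ∶ᵏ o p
  ∀ᶜ    : ∀ {τ p A} → A ∶ᵏ o p → ∀ᶜ τ A ∶ᵏ o p
  ↓     : ∀ {p A} → A ∶ᵏ o p → ↓ A ∶ᵏ o ⊕
  ↑     : ∀ {p A} → A ∶ᵏ o p → ↑ A ∶ᵏ o ⊖

-- There is deliberately no congruence rule for ↓ and ↑.
data _≅_ {Ξ : List Kind} : Con Ξ → Con Ξ → Set where
  ≅-refl  : ∀ {T} → T ≅ T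
  ≅-sym   : ∀ {T U} → T ≅ U → U ≅ T
  ≅-trans : ∀ {S T U} → S ≅ T → T ≅ U → S ≅ U
  β       : ∀ {τ T U} → ƛ τ T · U ≅ T [ U ]ᶜ
  η       : ∀ {τ T} → ƛ τ (wkᶜ T · var (here refl)) ≅ T
  rec-𝟎   : ∀ {τ T U} → rec τ · T · U · 𝟎 ≅ T
  rec-𝐬   : ∀ {τ T U n} → rec τ · T · U · (𝐬 · n) ≅ U · n · (rec τ · T · U · n)
  rec⊥-𝟎  : ∀ {τ T U} → rec⊥ τ · T · U · 𝟎 ≅ T ⊥
  rec⊥-𝐬  : ∀ {τ T U n} → rec⊥ τ · T · U · (𝐬 · n) ≅ U ⊥ · n · (rec τ · T · U · n)
  ƛ       : ∀ {τ T T′} → T ≅ T′ → ƛ τ T ≅ ƛ τ T′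
  _·_     : ∀ {T T′ U U′} → T ≅ T′ → U ≅ U′ → T · U ≅ T′ · U′
  _⊗_     : ∀ {A A′ B B′} → A ≅ A′ → B ≅ B′ → A ⊗ B ≅ A′ ⊗ B′
  _⅋_     : ∀ {A A′ B B′} → A ≅ A′ → B ≅ B′ → A ⅋ B ≅ A′ ⅋ B′
  ∃ᶜ      : ∀ {τ A A′} → A ≅ A′ → ∃ᶜ τ A ≅ ∃ᶜ τ A′
  ∀ᶜ      : ∀ {τ A A′} → A ≅ A′ → ∀ᶜ τ A ≅ ∀ᶜ τ A′

-- Γ : Ctx Ξ Θ is a finite set of declarations of pairwise distinct
-- variables from Θ: each variable of Θ has at most one declaration and may
-- have none.  The formulas have their free variables in Ξ.
Ctx : List Kind → List Polarity → Set
Ctx Ξ Θ = All (λ _ → Maybe (Con Ξ)) Θ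

∅ : ∀ {Ξ Θ} → Ctx Ξ Θ
∅ = All.universal (λ _ → nothing) _

infixl 6 _▸_∶_

-- Sets the declaration of i.  When i is the variable of a binder, in a
-- larger scope, this extension is written just A ∷ Γ instead.
_▸_∶_ : ∀ {Ξ Θ p} → Ctx Ξ Θ → p ∈ Θ → Con Ξ → Ctx Ξ Θ
Γ ▸ i ∶ A = Γ [ i ]≔ just A

infix 4 _undeclared-in_ _⊎_≋_

_undeclared-in_ : ∀ {Ξ Θ p} → p ∈ Θ → Ctx Ξ Θ → Set
i undeclared-in Γ = lookup Γ i ≡ nothing

wkᶜᵗˣ : ∀ {Ξ Θ σ} → Ctx Ξ Θ → Ctx (σ ∷ Ξ) Θ
wkᶜᵗˣ = All.map (Maybe.map wkᶜ)

-- Γ and Δ declare no variable in common, and their union is Λ.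
data _⊎_≋_ {Ξ : List Kind} : ∀ {Θ} → Ctx Ξ Θ → Ctx Ξ Θ → Ctx Ξ Θ → Set where
  []      : [] ⊎ [] ≋ []
  neither : ∀ {p Θ} {Γ Δ Λ : Ctx Ξ Θ} → Γ ⊎ Δ ≋ Λ →
            _∷_ {x = p} nothing Γ ⊎ nothing ∷ Δ ≋ nothing ∷ Λ
  left    : ∀ {p Θ A} {Γ Δ Λ : Ctx Ξ Θ} → Γ ⊎ Δ ≋ Λ →
            _∷_ {x = p} (just A) Γ ⊎ nothing ∷ Δ ≋ just A ∷ Λ
  right   : ∀ {p Θ A} {Γ Δ Λ : Ctx Ξ Θ} → Γ ⊎ Δ ≋ Λ →
            _∷_ {x = p} nothing Γ ⊎ just A ∷ Δ ≋ just A ∷ Λ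

-- 𝒦 p is the set of constants of polarity p.
module Calculus (𝒦 : Polarity → Set) where

  infix 8 ⟨_∣_⟩

  mutual

    -- Val Θ ⊕ is the grammar V₊.  Val Θ ⊖ is the whole grammar t₋, since
    -- every negative term is a value.  A value V of either polarity
    -- inhabits Val Θ p for some p.  In μpair p q c, the variables κ and κ′,
    -- of polarities p and q, are here refl and there (here refl).
    data Val (Θ : List Polarity) : Polarity → Set where
      var   : ∀ {p} → p ∈ Θ → Val Θ p
      const : ∀ {p} → 𝒦 p → Val Θ p
      pair  : ∀ {p q} → Val Θ p → Val Θ q → Val Θ ⊕
      box   : ∀ {p} → Val Θ p → Val Θ ⊕
      μpair : ∀ p q → Cmd (p ∷ q ∷ Θ) → Val Θ ⊖
      μbox  : ∀ p → Cmd (p ∷ Θ) → Val Θ ⊖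
      μ₋    : Cmd (⊕ ∷ Θ) → Val Θ ⊖

    data Term (Θ : List Polarity) : Polarity → Set where
      val : ∀ {p} → Val Θ p → Term Θ p
      μ₊  : Cmd (⊖ ∷ Θ) → Term Θ ⊕

    -- ⟨ t ∣ u ⟩ and ⟨ u ∣ t ⟩ being identified, the positive side is
    -- always written first.
    data Cmd (Θ : List Polarity) : Set where
      ⟨_∣_⟩ : Term Θ ⊕ → Term Θ ⊖ → Cmd Θ

  -- Every production of the grammar counts for one symbol; the inclusion
  -- val of values into terms is not a symbol.
  mutual

    ∣_∣ᵛ : ∀ {Θ p} → Val Θ p → ℕ
    ∣ var x ∣ᵛ       = 1
    ∣ const k ∣ᵛ     = 1
    ∣ pair V W ∣ᵛ    = suc (∣ V ∣ᵛ + ∣ W ∣ᵛ)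
    ∣ box V ∣ᵛ       = suc ∣ V ∣ᵛ
    ∣ μpair p q c ∣ᵛ = suc ∣ c ∣
    ∣ μbox p c ∣ᵛ    = suc ∣ c ∣
    ∣ μ₋ c ∣ᵛ        = suc ∣ c ∣

    ∣_∣ᵗ : ∀ {Θ p} → Term Θ p → ℕ
    ∣ val V ∣ᵗ = ∣ V ∣ᵛ
    ∣ μ₊ c ∣ᵗ  = suc ∣ c ∣

    ∣_∣ : ∀ {Θ} → Cmd Θ → ℕ
    ∣ ⟨ t ∣ u ⟩ ∣ = suc (∣ t ∣ᵗ + ∣ u ∣ᵗ)

  mutual

    renᵛ : ∀ {Θ Θ′ p} → Θ ⊆ Θ′ → Val Θ p → Val Θ′ p
    renᵛ ρ (var x)       = var (ρ x)
    renᵛ ρ (const k)     = const k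
    renᵛ ρ (pair V W)    = pair (renᵛ ρ V) (renᵛ ρ W)
    renᵛ ρ (box V)       = box (renᵛ ρ V)
    renᵛ ρ (μpair p q c) = μpair p q (ren (liftᴿ (liftᴿ ρ)) c)
    renᵛ ρ (μbox p c)    = μbox p (ren (liftᴿ ρ) c)
    renᵛ ρ (μ₋ c)        = μ₋ (ren (liftᴿ ρ) c)

    renᵗ : ∀ {Θ Θ′ p} → Θ ⊆ Θ′ → Term Θ p → Term Θ′ p
    renᵗ ρ (val V) = val (renᵛ ρ V)
    renᵗ ρ (μ₊ c)  = μ₊ (ren (liftᴿ ρ) c)

    ren : ∀ {Θ Θ′} → Θ ⊆ Θ′ → Cmd Θ → Cmd Θ′
    ren ρ ⟨ t ∣ u ⟩ = ⟨ renᵗ ρ t ∣ renᵗ ρ u ⟩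

  Sub : List Polarity → List Polarity → Set
  Sub Θ Θ′ = ∀ {p} → p ∈ Θ → Val Θ′ p

  lift : ∀ {Θ Θ′ q} → Sub Θ Θ′ → Sub (q ∷ Θ) (q ∷ Θ′)
  lift s (here refl) = var (here refl)
  lift s (there x)   = renᵛ there (s x)

  mutual

    subᵛ : ∀ {Θ Θ′ p} → Sub Θ Θ′ → Val Θ p → Val Θ′ p
    subᵛ s (var x)       = s x
    subᵛ s (const k)     = const k
    subᵛ s (pair V W)    = pair (subᵛ s V) (subᵛ s W)
    subᵛ s (box V)       = box (subᵛ s V)
    subᵛ s (μpair p q c) = μpair p q (sub (lift (lift s)) c)
    subᵛ s (μbox p c)    = μbox p (sub (lift s) c)
    subᵛ s (μ₋ c)        = μ₋ (sub (lift s) c)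

    subᵗ : ∀ {Θ Θ′ p} → Sub Θ Θ′ → Term Θ p → Term Θ′ p
    subᵗ s (val V) = val (subᵛ s V)
    subᵗ s (μ₊ c)  = μ₊ (sub (lift s) c)

    sub : ∀ {Θ Θ′} → Sub Θ Θ′ → Cmd Θ → Cmd Θ′
    sub s ⟨ t ∣ u ⟩ = ⟨ subᵗ s t ∣ subᵗ s u ⟩

  infixl 5 _,ˢ_

  _,ˢ_ : ∀ {Θ Θ′ q} → Sub Θ Θ′ → Val Θ′ q → Sub (q ∷ Θ) Θ′
  (s ,ˢ V) (here refl) = V
  (s ,ˢ V) (there x)   = s x

  infix 9 _[_] _[_,_]

  _[_] : ∀ {Θ p} → Cmd (p ∷ Θ) → Val Θ p → Cmd Θ
  c [ V ] = sub (var ,ˢ V) c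

  _[_,_] : ∀ {Θ p q} → Cmd (p ∷ q ∷ Θ) → Val Θ p → Val Θ q → Cmd Θ
  c [ V , W ] = sub (var ,ˢ W ,ˢ V) c

  infix 4 _⟶μ_ _⟶β_ _⟶₀_

  data _⟶μ_ {Θ : List Polarity} : Cmd Θ → Cmd Θ → Set where
    μ₊ : ∀ {c V} → ⟨ μ₊ c ∣ val V ⟩ ⟶μ c [ V ]
    μ₋ : ∀ {c V} → ⟨ val V ∣ val (μ₋ c) ⟩ ⟶μ c [ V ]

  data _⟶β_ {Θ : List Polarity} : Cmd Θ → Cmd Θ → Set where
    β↓ : ∀ {p c} {V : Val Θ p} →
         ⟨ val (box V) ∣ val (μbox p c) ⟩ ⟶β c [ V ]
    β⊗ : ∀ {p q c} {V : Val Θ p} {W : Val Θ q} →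
         ⟨ val (pair V W) ∣ val (μpair p q c) ⟩ ⟶β c [ V , W ]

  _⟶₀_ : ∀ {Θ} → Cmd Θ → Cmd Θ → Set
  _⟶₀_ = _⟶β_ ∪ _⟶μ_

  #β : ∀ {Θ} {c c′ : Cmd Θ} → Star _⟶₀_ c c′ → ℕ
  #β ε             = 0
  #β (inj₁ _ ◅ rs) = suc (#β rs)
  #β (inj₂ _ ◅ rs) = #β rs

  infix 3 ⊢_∶_∣_ _∶⊢_

  mutual

    -- Formulas are kinded wherever they are introduced, so that every
    -- derivable ⊢ t ∶ A ∣ Γ with t : Term Θ p has A ∶ᵏ o p, and every
    -- variable of polarity p declared in Γ has a formula of kind
    -- o (opposite p).
    data ⊢_∶_∣_ {Ξ : List Kind} {Θ : List Polarity} :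
                ∀ {p} → Term Θ p → Con Ξ → Ctx Ξ Θ → Set where

      ax : ∀ {p A} (i : p ∈ Θ) → A ∶ᵏ o p →
           ⊢ val (var i) ∶ A ∣ ∅ ▸ i ∶ A ⊥

      μ₊ : ∀ {P Γ} {c : Cmd (⊖ ∷ Θ)} →
           c ∶⊢ just P ∷ Γ →
           ⊢ μ₊ c ∶ P ∣ Γ

      μ₋ : ∀ {N Γ} {c : Cmd (⊕ ∷ Θ)} →
           c ∶⊢ just N ∷ Γ →
           ⊢ val (μ₋ c) ∶ N ∣ Γ

      ⊗I : ∀ {p q A B Γ Δ Λ} {V : Val Θ p} {W : Val Θ q} →
           Γ ⊎ Δ ≋ Λ →
           ⊢ val V ∶ A ∣ Γ →
           ⊢ val W ∶ B ∣ Δ →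
           ⊢ val (pair V W) ∶ A ⊗ B ∣ Λ

      ⅋I : ∀ {p q A B Γ} {c : Cmd (p ∷ q ∷ Θ)} →
           c ∶⊢ just A ∷ just B ∷ Γ →
           ⊢ val (μpair p q c) ∶ A ⅋ B ∣ Γ

      ↓I : ∀ {p A Γ} {V : Val Θ p} →
           ⊢ val V ∶ A ∣ Γ →
           ⊢ val (box V) ∶ ↓ A ∣ Γ

      ↑I : ∀ {p A Γ} {c : Cmd (p ∷ Θ)} →
           c ∶⊢ just A ∷ Γ →
           ⊢ val (μbox p c) ∶ ↑ A ∣ Γ

      ∃I : ∀ {p τ A T Γ} {t : Term Θ p} →
           A ∶ᵏ o p →
           T ∶ᵏ τ →
           ⊢ t ∶ A [ T ]ᶜ ∣ Γ →
           ⊢ t ∶ ∃ᶜ τ A ∣ Γ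

      ∀I : ∀ {p τ A Γ} {V : Val Θ p} →
           ⊢ val V ∶ A ∣ wkᶜᵗˣ Γ →
           ⊢ val V ∶ ∀ᶜ τ A ∣ Γ

    data _∶⊢_ {Ξ : List Kind} {Θ : List Polarity} : Cmd Θ → Ctx Ξ Θ → Set where

      cut : ∀ {A Γ Δ Λ} {t : Term Θ ⊕} {u : Term Θ ⊖} →
            Γ ⊎ Δ ≋ Λ →
            ⊢ t ∶ A ∣ Γ →
            ⊢ u ∶ A ⊥ ∣ Δ →
            ⟨ t ∣ u ⟩ ∶⊢ Λ

      conv : ∀ {p A B Γ} {c : Cmd Θ} (i : p ∈ Θ) →
             A ≅ B →
             B ∶ᵏ o (opposite p) →
             c ∶⊢ Γ ▸ i ∶ A →
             c ∶⊢ Γ ▸ i ∶ B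

      weak : ∀ {p A Γ} {c : Cmd Θ} (i : p ∈ Θ) →
             i undeclared-in Γ →
             A ∶ᵏ o (opposite p) →
             c ∶⊢ Γ →
             c ∶⊢ Γ ▸ i ∶ A

  -- One reduction sequence to a normal form is enough, because ⟶₀ is
  -- deterministic: ⟨ μ₊ c ∣ val (μ₋ c′) ⟩ has a single reduct.
  NormalizesWithin : ∀ {Θ} → ℕ → Cmd Θ → Set
  NormalizesWithin n c =
    ∃[ c′ ] Σ[ r ∈ Star _⟶₀_ c c′ ] IsNormalForm _⟶₀_ c′ × #β r ≤ n

{-# OPTIONS --safe #-}

-- Weigh a command by its number of cuts plus the weights of its free variable
-- occurrences.  Substitution then merely changes the weights of the variables,
-- by ‖ c [ V ] ‖ w = ‖ c ‖ (w ▹ ‖ V ‖ w).  That a variable occurs at most once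
-- says that giving it weight n instead of 0 adds at most n, a condition stable
-- under every substitution for the other variables.  Typable commands satisfy
-- it at all binders, so each step, which consumes a cut, lowers the number of
-- cuts; and there are at most ∣ c ∣ of these.

module Submission where

open import Defs
open import Data.List.Base using (List; []; _∷_)
open import Data.List.Membership.Propositional using (_∈_)
open import Data.List.Relation.Binary.Subset.Propositional using (_⊆_)
open import Data.List.Relation.Unary.All using ([]; _∷_)
open import Data.List.Relation.Unary.Any using (here; there)
open import Data.Maybe.Base using (just; nothing)
open import Data.Nat.Base using (ℕ; zero; suc; _+_; _≤_; _<_; z≤n; s≤s; s≤s⁻¹)
open import Data.Nat.Properties
open import Algebra.Properties.CommutativeSemigroup +-commutativeSemigroup
  using (interchange)
open import Data.Product.Base using (∃-syntax; _×_; _,_)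
import Data.Sign.Properties as Sign
open import Data.Sum.Base using (inj₁; inj₂)
open import Data.Unit.Base using (⊤; tt)
open import Relation.Binary.Construct.Closure.ReflexiveTransitive using (ε; _◅_)
open import Relation.Binary.PropositionalEquality
  using (_≡_; refl; sym; trans; cong; cong₂; subst)
open import Relation.Nullary using (Dec; yes; no)

private
  variable
    Ξ : List Kind
    Θ Θ′ : List Polarity
    p q : Polarity

-- Weights of variables and their sums over contexts.

Weight : List Polarity → Set
Weight Θ = ∀ {p} → p ∈ Θ → ℕ

infixl 5 _▹_

_▹_ : Weight Θ → ℕ → Weight (p ∷ Θ)
(w ▹ n) (here refl) = n
(w ▹ n) (there i)   = w i

𝟘 : Weight Θ
𝟘 _ = 0

-- This will bound the growth of a weight when the variables get heavier by `v`. The formulas are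
-- ignored, so neither conversion nor a new type variable affects it.
total : Ctx Ξ Θ → Weight Θ → ℕ
total []            v = 0
total (just _ ∷ Γ)  v = v (here refl) + total Γ (λ i → v (there i))
total (nothing ∷ Γ) v = total Γ (λ i → v (there i))

total-𝟘 : (Γ : Ctx Ξ Θ) → total Γ 𝟘 ≡ 0
total-𝟘 []            = refl
total-𝟘 (just _ ∷ Γ)  = total-𝟘 Γ
total-𝟘 (nothing ∷ Γ) = total-𝟘 Γ

total-⊎ : {Γ Δ Λ : Ctx Ξ Θ} → Γ ⊎ Δ ≋ Λ → (v : Weight Θ) →
          total Λ v ≡ total Γ v + total Δ v
total-⊎ []            v = refl
total-⊎ (neither Γ⊎Δ) v = total-⊎ Γ⊎Δ _
total-⊎ (left Γ⊎Δ)    v =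
  trans (cong (v (here refl) +_) (total-⊎ Γ⊎Δ _)) (sym (+-assoc (v (here refl)) _ _))
total-⊎ {Γ = _ ∷ Γ} {Δ = _ ∷ Δ} (right Γ⊎Δ) v =
  trans (cong (v (here refl) +_)
          (trans (total-⊎ Γ⊎Δ _) (+-comm (total Γ _) (total Δ _))))
        (trans (sym (+-assoc (v (here refl)) _ _)) (+-comm _ (total Γ _)))

total-wk : ∀ {σ} (Γ : Ctx Ξ Θ) (v : Weight Θ) →
           total (wkᶜᵗˣ {σ = σ} Γ) v ≡ total Γ v
total-wk []            v = refl
total-wk (just _ ∷ Γ)  v = cong (v (here refl) +_) (total-wk Γ _)
total-wk (nothing ∷ Γ) v = total-wk Γ _

total-▸-irrelevant : ∀ {A B} (Γ : Ctx Ξ Θ) (i : p ∈ Θ) (v : Weight Θ) →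
                     total (Γ ▸ i ∶ A) v ≡ total (Γ ▸ i ∶ B) v
total-▸-irrelevant (_ ∷ Γ)       (here refl) v = refl
total-▸-irrelevant (just _ ∷ Γ)  (there i)   v =
  cong (v (here refl) +_) (total-▸-irrelevant Γ i _)
total-▸-irrelevant (nothing ∷ Γ) (there i)   v = total-▸-irrelevant Γ i _

total≤total-▸ : ∀ {A} (Γ : Ctx Ξ Θ) (i : p ∈ Θ) (v : Weight Θ) →
                total Γ v ≤ total (Γ ▸ i ∶ A) v
total≤total-▸ (just _ ∷ Γ)  (here refl) v = ≤-refl
total≤total-▸ (nothing ∷ Γ) (here refl) v = m≤n+m _ (v (here refl))
total≤total-▸ (just _ ∷ Γ)  (there i)   v =
  +-monoʳ-≤ (v (here refl)) (total≤total-▸ Γ i _)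
total≤total-▸ (nothing ∷ Γ) (there i)   v = total≤total-▸ Γ i _

weight≤total-▸ : ∀ {A} (Γ : Ctx Ξ Θ) (i : p ∈ Θ) (v : Weight Θ) →
                 v i ≤ total (Γ ▸ i ∶ A) v
weight≤total-▸ (_ ∷ Γ)       (here refl) v = m≤m+n (v (here refl)) _
weight≤total-▸ (just _ ∷ Γ)  (there i)   v =
  ≤-trans (weight≤total-▸ Γ i _) (m≤n+m _ (v (here refl)))
weight≤total-▸ (nothing ∷ Γ) (there i)   v = weight≤total-▸ Γ i _

module _ (𝒦 : Polarity → Set) where

  open Calculus 𝒦

  -- Weights of commands and their bound by the size.

  mutual

    -- Bound variables weigh 0, but cuts below binders count, as later steps may expose them.
    ‖_‖ᵛ : Val Θ p → Weight Θ → ℕ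
    ‖ var i ‖ᵛ       w = w i
    ‖ const k ‖ᵛ     w = 0
    ‖ pair V W ‖ᵛ    w = ‖ V ‖ᵛ w + ‖ W ‖ᵛ w
    ‖ box V ‖ᵛ       w = ‖ V ‖ᵛ w
    ‖ μpair p q c ‖ᵛ w = ‖ c ‖ (w ▹ 0 ▹ 0)
    ‖ μbox p c ‖ᵛ    w = ‖ c ‖ (w ▹ 0)
    ‖ μ₋ c ‖ᵛ        w = ‖ c ‖ (w ▹ 0)

    ‖_‖ᵗ : Term Θ p → Weight Θ → ℕ
    ‖ val V ‖ᵗ w = ‖ V ‖ᵛ w
    ‖ μ₊ c ‖ᵗ  w = ‖ c ‖ (w ▹ 0)

    ‖_‖ : Cmd Θ → Weight Θ → ℕ
    ‖ ⟨ t ∣ u ⟩ ‖ w = suc (‖ t ‖ᵗ w + ‖ u ‖ᵗ w)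

  ▹-≤1 : {w : Weight Θ} → (∀ {p} (i : p ∈ Θ) → w i ≤ 1) →
         ∀ {p} (i : p ∈ q ∷ Θ) → (w ▹ 0) i ≤ 1
  ▹-≤1 w≤1 (here refl) = z≤n
  ▹-≤1 w≤1 (there i)   = w≤1 i

  mutual

    -- A cut and a variable occurrence are one symbol each, so free variables may weigh up to 1.
    weight≤sizeᵛ : (V : Val Θ p) {w : Weight Θ} → (∀ {p} (i : p ∈ Θ) → w i ≤ 1) →
                   ‖ V ‖ᵛ w ≤ ∣ V ∣ᵛ
    weight≤sizeᵛ (var i)       w≤1 = w≤1 i
    weight≤sizeᵛ (const k)     w≤1 = z≤n
    weight≤sizeᵛ (pair V W)    w≤1 =
      m≤n⇒m≤1+n (+-mono-≤ (weight≤sizeᵛ V w≤1) (weight≤sizeᵛ W w≤1))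
    weight≤sizeᵛ (box V)       w≤1 = m≤n⇒m≤1+n (weight≤sizeᵛ V w≤1)
    weight≤sizeᵛ (μpair p q c) w≤1 = m≤n⇒m≤1+n (weight≤size c (▹-≤1 (▹-≤1 w≤1)))
    weight≤sizeᵛ (μbox p c)    w≤1 = m≤n⇒m≤1+n (weight≤size c (▹-≤1 w≤1))
    weight≤sizeᵛ (μ₋ c)        w≤1 = m≤n⇒m≤1+n (weight≤size c (▹-≤1 w≤1))

    weight≤sizeᵗ : (t : Term Θ p) {w : Weight Θ} → (∀ {p} (i : p ∈ Θ) → w i ≤ 1) →
                   ‖ t ‖ᵗ w ≤ ∣ t ∣ᵗ
    weight≤sizeᵗ (val V) w≤1 = weight≤sizeᵛ V w≤1
    weight≤sizeᵗ (μ₊ c)  w≤1 = m≤n⇒m≤1+n (weight≤size c (▹-≤1 w≤1))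

    weight≤size : (c : Cmd Θ) {w : Weight Θ} → (∀ {p} (i : p ∈ Θ) → w i ≤ 1) →
                  ‖ c ‖ w ≤ ∣ c ∣
    weight≤size ⟨ t ∣ u ⟩ w≤1 = s≤s (+-mono-≤ (weight≤sizeᵗ t w≤1) (weight≤sizeᵗ u w≤1))

  -- Weights under renaming and substitution.

  liftᴿ-weight : {ρ : Θ ⊆ Θ′} {w : Weight Θ} {w′ : Weight Θ′} {n : ℕ} →
                 (∀ {p} (i : p ∈ Θ) → w′ (ρ i) ≡ w i) →
                 ∀ {p} (i : p ∈ q ∷ Θ) → (w′ ▹ n) (liftᴿ ρ i) ≡ (w ▹ n) i
  liftᴿ-weight h (here refl) = refl
  liftᴿ-weight h (there i)   = h i

  mutual

    -- The two weights are related pointwise because, below a binder, extending by 0 and composing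
    -- with the renaming commute only pointwise.
    ren-weightᵛ : {ρ : Θ ⊆ Θ′} {w : Weight Θ} {w′ : Weight Θ′} (V : Val Θ p) →
                  (∀ {p} (i : p ∈ Θ) → w′ (ρ i) ≡ w i) →
                  ‖ renᵛ ρ V ‖ᵛ w′ ≡ ‖ V ‖ᵛ w
    ren-weightᵛ (var i)       h = h i
    ren-weightᵛ (const k)     h = refl
    ren-weightᵛ (pair V W)    h = cong₂ _+_ (ren-weightᵛ V h) (ren-weightᵛ W h)
    ren-weightᵛ (box V)       h = ren-weightᵛ V h
    ren-weightᵛ (μpair p q c) h = ren-weight c (liftᴿ-weight (liftᴿ-weight h))
    ren-weightᵛ (μbox p c)    h = ren-weight c (liftᴿ-weight h)
    ren-weightᵛ (μ₋ c)        h = ren-weight c (liftᴿ-weight h)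

    ren-weightᵗ : {ρ : Θ ⊆ Θ′} {w : Weight Θ} {w′ : Weight Θ′} (t : Term Θ p) →
                  (∀ {p} (i : p ∈ Θ) → w′ (ρ i) ≡ w i) →
                  ‖ renᵗ ρ t ‖ᵗ w′ ≡ ‖ t ‖ᵗ w
    ren-weightᵗ (val V) h = ren-weightᵛ V h
    ren-weightᵗ (μ₊ c)  h = ren-weight c (liftᴿ-weight h)

    ren-weight : {ρ : Θ ⊆ Θ′} {w : Weight Θ} {w′ : Weight Θ′} (c : Cmd Θ) →
                 (∀ {p} (i : p ∈ Θ) → w′ (ρ i) ≡ w i) →
                 ‖ ren ρ c ‖ w′ ≡ ‖ c ‖ w
    ren-weight ⟨ t ∣ u ⟩ h = cong suc (cong₂ _+_ (ren-weightᵗ t h) (ren-weightᵗ u h))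

  -- A shifted value does not mention the new variable, whose weight `n` is therefore arbitrary: 0
  -- when passing a binder, nonzero values in `sub-once`.
  lift-weight : {s : Sub Θ Θ′} {w : Weight Θ} {w′ : Weight Θ′} {n : ℕ} →
                (∀ {p} (i : p ∈ Θ) → ‖ s i ‖ᵛ w′ ≡ w i) →
                ∀ {p} (i : p ∈ q ∷ Θ) → ‖ lift s i ‖ᵛ (w′ ▹ n) ≡ (w ▹ n) i
  lift-weight         h (here refl) = refl
  lift-weight {s = s} h (there i)   = trans (ren-weightᵛ (s i) (λ _ → refl)) (h i)

  mutual

    -- Each occurrence of `i` is replaced by a copy of `s i`, which brings its own cuts and free
    -- occurrences. Pulling `w′` back along `s` thus accounts for every copy.
    sub-weightᵛ : {s : Sub Θ Θ′} {w : Weight Θ} {w′ : Weight Θ′} (V : Val Θ p) →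
                  (∀ {p} (i : p ∈ Θ) → ‖ s i ‖ᵛ w′ ≡ w i) →
                  ‖ subᵛ s V ‖ᵛ w′ ≡ ‖ V ‖ᵛ w
    sub-weightᵛ (var i)       h = h i
    sub-weightᵛ (const k)     h = refl
    sub-weightᵛ (pair V W)    h = cong₂ _+_ (sub-weightᵛ V h) (sub-weightᵛ W h)
    sub-weightᵛ (box V)       h = sub-weightᵛ V h
    sub-weightᵛ (μpair p q c) h = sub-weight c (lift-weight (lift-weight h))
    sub-weightᵛ (μbox p c)    h = sub-weight c (lift-weight h)
    sub-weightᵛ (μ₋ c)        h = sub-weight c (lift-weight h)

    sub-weightᵗ : {s : Sub Θ Θ′} {w : Weight Θ} {w′ : Weight Θ′} (t : Term Θ p) →
                  (∀ {p} (i : p ∈ Θ) → ‖ s i ‖ᵛ w′ ≡ w i) →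
                  ‖ subᵗ s t ‖ᵗ w′ ≡ ‖ t ‖ᵗ w
    sub-weightᵗ (val V) h = sub-weightᵛ V h
    sub-weightᵗ (μ₊ c)  h = sub-weight c (lift-weight h)

    sub-weight : {s : Sub Θ Θ′} {w : Weight Θ} {w′ : Weight Θ′} (c : Cmd Θ) →
                 (∀ {p} (i : p ∈ Θ) → ‖ s i ‖ᵛ w′ ≡ w i) →
                 ‖ sub s c ‖ w′ ≡ ‖ c ‖ w
    sub-weight ⟨ t ∣ u ⟩ h = cong suc (cong₂ _+_ (sub-weightᵗ t h) (sub-weightᵗ u h))

  -- Affinity and its stability under substitution.

  AtMostOnce : Cmd (p ∷ Θ) → Set
  AtMostOnce {Θ = Θ} c = (w : Weight Θ) (n : ℕ) → ‖ c ‖ (w ▹ n) ≤ ‖ c ‖ (w ▹ 0) + n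

  -- The two weights are raised together because `β⊗` replaces both variables at once; `m` belongs
  -- to `here refl`.
  AtMostOnce₂ : Cmd (p ∷ q ∷ Θ) → Set
  AtMostOnce₂ {Θ = Θ} c = (w : Weight Θ) (m n : ℕ) →
                         ‖ c ‖ (w ▹ n ▹ m) ≤ ‖ c ‖ (w ▹ 0 ▹ 0) + (m + n)

  mutual

    -- The condition is hereditary: a step exposes the body of a binder, and the binders inside must
    -- then be affine too.
    Affineᵛ : Val Θ p → Set
    Affineᵛ (var i)       = ⊤
    Affineᵛ (const k)     = ⊤
    Affineᵛ (pair V W)    = Affineᵛ V × Affineᵛ W
    Affineᵛ (box V)       = Affineᵛ V
    Affineᵛ (μpair p q c) = AtMostOnce₂ c × Affine c
    Affineᵛ (μbox p c)    = AtMostOnce c × Affine c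
    Affineᵛ (μ₋ c)        = AtMostOnce c × Affine c

    Affineᵗ : Term Θ p → Set
    Affineᵗ (val V) = Affineᵛ V
    Affineᵗ (μ₊ c)  = AtMostOnce c × Affine c

    Affine : Cmd Θ → Set
    Affine ⟨ t ∣ u ⟩ = Affineᵗ t × Affineᵗ u

  ren-once : {ρ : Θ ⊆ Θ′} (c : Cmd (p ∷ Θ)) → AtMostOnce c → AtMostOnce (ren (liftᴿ ρ) c)
  ren-once {ρ = ρ} c once w n
    rewrite ren-weight {ρ = liftᴿ ρ} {w′ = w ▹ n} c (liftᴿ-weight (λ _ → refl))
          | ren-weight {ρ = liftᴿ ρ} {w′ = w ▹ 0} c (liftᴿ-weight (λ _ → refl))
    = once (λ i → w (ρ i)) n

  ren-once₂ : {ρ : Θ ⊆ Θ′} (c : Cmd (p ∷ q ∷ Θ)) →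
              AtMostOnce₂ c → AtMostOnce₂ (ren (liftᴿ (liftᴿ ρ)) c)
  ren-once₂ {ρ = ρ} c once w m n
    rewrite ren-weight {ρ = liftᴿ (liftᴿ ρ)} {w′ = w ▹ n ▹ m} c
              (liftᴿ-weight (liftᴿ-weight (λ _ → refl)))
          | ren-weight {ρ = liftᴿ (liftᴿ ρ)} {w′ = w ▹ 0 ▹ 0} c
              (liftᴿ-weight (liftᴿ-weight (λ _ → refl)))
    = once (λ i → w (ρ i)) m n

  mutual

    ren-affineᵛ : {ρ : Θ ⊆ Θ′} (V : Val Θ p) → Affineᵛ V → Affineᵛ (renᵛ ρ V)
    ren-affineᵛ (var i)       _          = tt
    ren-affineᵛ (const k)     _          = tt
    ren-affineᵛ (pair V W)    (a , b)    = ren-affineᵛ V a , ren-affineᵛ W b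
    ren-affineᵛ (box V)       a          = ren-affineᵛ V a
    ren-affineᵛ (μpair p q c) (once , a) = ren-once₂ c once , ren-affine c a
    ren-affineᵛ (μbox p c)    (once , a) = ren-once c once , ren-affine c a
    ren-affineᵛ (μ₋ c)        (once , a) = ren-once c once , ren-affine c a

    ren-affineᵗ : {ρ : Θ ⊆ Θ′} (t : Term Θ p) → Affineᵗ t → Affineᵗ (renᵗ ρ t)
    ren-affineᵗ (val V) a          = ren-affineᵛ V a
    ren-affineᵗ (μ₊ c)  (once , a) = ren-once c once , ren-affine c a

    ren-affine : {ρ : Θ ⊆ Θ′} (c : Cmd Θ) → Affine c → Affine (ren ρ c)
    ren-affine ⟨ t ∣ u ⟩ (a , b) = ren-affineᵗ t a , ren-affineᵗ u b

  -- The substitution only changes the weights of the other variables, from `w` to those of the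
  -- values replacing them, and `AtMostOnce` allows all weights there.
  sub-once : {s : Sub Θ Θ′} (c : Cmd (p ∷ Θ)) → AtMostOnce c → AtMostOnce (sub (lift s) c)
  sub-once {s = s} c once w n
    rewrite sub-weight {s = lift s} {w′ = w ▹ n} c (lift-weight (λ _ → refl))
          | sub-weight {s = lift s} {w′ = w ▹ 0} c (lift-weight (λ _ → refl))
    = once (λ i → ‖ s i ‖ᵛ w) n

  sub-once₂ : {s : Sub Θ Θ′} (c : Cmd (p ∷ q ∷ Θ)) →
              AtMostOnce₂ c → AtMostOnce₂ (sub (lift (lift s)) c)
  sub-once₂ {s = s} c once w m n
    rewrite sub-weight {s = lift (lift s)} {w′ = w ▹ n ▹ m} c
              (lift-weight (lift-weight (λ _ → refl)))
          | sub-weight {s = lift (lift s)} {w′ = w ▹ 0 ▹ 0} c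
              (lift-weight (lift-weight (λ _ → refl)))
    = once (λ i → ‖ s i ‖ᵛ w) m n

  AffineSub : Sub Θ Θ′ → Set
  AffineSub {Θ = Θ} s = ∀ {p} (i : p ∈ Θ) → Affineᵛ (s i)

  lift-affine : {s : Sub Θ Θ′} → AffineSub s → AffineSub (lift {q = q} s)
  lift-affine         h (here refl) = tt
  lift-affine {s = s} h (there i)   = ren-affineᵛ (s i) (h i)

  ,ˢ-affine : {s : Sub Θ Θ′} {V : Val Θ′ p} →
              AffineSub s → Affineᵛ V → AffineSub (s ,ˢ V)
  ,ˢ-affine h a (here refl) = a
  ,ˢ-affine h a (there i)   = h i

  mutual

    sub-affineᵛ : {s : Sub Θ Θ′} (V : Val Θ p) →
                  AffineSub s → Affineᵛ V → Affineᵛ (subᵛ s V)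
    sub-affineᵛ (var i)       h _          = h i
    sub-affineᵛ (const k)     h _          = tt
    sub-affineᵛ (pair V W)    h (a , b)    = sub-affineᵛ V h a , sub-affineᵛ W h b
    sub-affineᵛ (box V)       h a          = sub-affineᵛ V h a
    sub-affineᵛ (μpair p q c) h (once , a) =
      sub-once₂ c once , sub-affine c (lift-affine (lift-affine h)) a
    sub-affineᵛ (μbox p c)    h (once , a) = sub-once c once , sub-affine c (lift-affine h) a
    sub-affineᵛ (μ₋ c)        h (once , a) = sub-once c once , sub-affine c (lift-affine h) a

    sub-affineᵗ : {s : Sub Θ Θ′} (t : Term Θ p) →
                  AffineSub s → Affineᵗ t → Affineᵗ (subᵗ s t)
    sub-affineᵗ (val V) h a          = sub-affineᵛ V h a
    sub-affineᵗ (μ₊ c)  h (once , a) = sub-once c once , sub-affine c (lift-affine h) a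

    sub-affine : {s : Sub Θ Θ′} (c : Cmd Θ) → AffineSub s → Affine c → Affine (sub s c)
    sub-affine ⟨ t ∣ u ⟩ h (a , b) = sub-affineᵗ t h a , sub-affineᵗ u h b

  -- Typable commands are affine.

  ▹-mono : {w w′ v : Weight Θ} {k m n : ℕ} → m ≤ k + n →
           (∀ {p} (i : p ∈ Θ) → w′ i ≤ w i + v i) →
           ∀ {p} (i : p ∈ q ∷ Θ) → (w′ ▹ m) i ≤ (w ▹ k) i + (v ▹ n) i
  ▹-mono m≤k+n h (here refl) = m≤k+n
  ▹-mono m≤k+n h (there i)   = h i

  -- This is where the disjointness of contexts enters: the increases on the two sides are charged
  -- to different declarations, so they add up within `Λ`.
  +-mono-⊎ : ∀ {a a′ b b′} {Γ Δ Λ : Ctx Ξ Θ} {v : Weight Θ} → Γ ⊎ Δ ≋ Λ →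
             a′ ≤ a + total Γ v → b′ ≤ b + total Δ v → a′ + b′ ≤ (a + b) + total Λ v
  +-mono-⊎ {a = a} {a′} {b} {b′} {Γ} {Δ} {Λ} {v} Γ⊎Δ a′≤ b′≤ = begin
    a′ + b′                             ≤⟨ +-mono-≤ a′≤ b′≤ ⟩
    (a + total Γ v) + (b + total Δ v)   ≡⟨ interchange a _ b _ ⟩
    (a + b) + (total Γ v + total Δ v)   ≡⟨ cong (a + b +_) (total-⊎ Γ⊎Δ v) ⟨
    (a + b) + total Λ v                 ∎
    where open ≤-Reasoning

  mutual

    -- By induction on the derivation: free variables are declared, and each occurs at most once, so
    -- raising the weights by at most `v` costs at most `v` once per declaration. Raising all
    -- variables simultaneously lets the two-premise rules simply add their bounds.
    typed-weightᵗ : {t : Term Θ p} {A : Con Ξ} {Γ : Ctx Ξ Θ} {w w′ v : Weight Θ} →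
                    ⊢ t ∶ A ∣ Γ → (∀ {p} (i : p ∈ Θ) → w′ i ≤ w i + v i) →
                    ‖ t ‖ᵗ w′ ≤ ‖ t ‖ᵗ w + total Γ v
    typed-weightᵗ {w = w} {v = v} (ax i _) h =
      ≤-trans (h i) (+-monoʳ-≤ (w i) (weight≤total-▸ ∅ i v))
    -- The bound variable keeps weight 0, so with `n = 0` its declaration adds nothing to the total,
    -- which computes to that of the outer context.
    typed-weightᵗ (μ₊ d)        h = typed-weight d (▹-mono {n = 0} z≤n h)
    typed-weightᵗ (μ₋ d)        h = typed-weight d (▹-mono {n = 0} z≤n h)
    typed-weightᵗ (⊗I Γ⊎Δ d e)  h =
      +-mono-⊎ Γ⊎Δ (typed-weightᵗ d h) (typed-weightᵗ e h)
    typed-weightᵗ (⅋I d)        h = typed-weight d (▹-mono {n = 0} z≤n (▹-mono {n = 0} z≤n h))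
    typed-weightᵗ (↓I d)        h = typed-weightᵗ d h
    typed-weightᵗ (↑I d)        h = typed-weight d (▹-mono {n = 0} z≤n h)
    typed-weightᵗ (∃I _ _ d)    h = typed-weightᵗ d h
    typed-weightᵗ {t = t} {Γ = Γ} {w} {w′} {v} (∀I d) h =
      subst (λ n → ‖ t ‖ᵗ w′ ≤ ‖ t ‖ᵗ w + n) (total-wk Γ v) (typed-weightᵗ d h)

    typed-weight : {c : Cmd Θ} {Γ : Ctx Ξ Θ} {w w′ v : Weight Θ} →
                   c ∶⊢ Γ → (∀ {p} (i : p ∈ Θ) → w′ i ≤ w i + v i) →
                   ‖ c ‖ w′ ≤ ‖ c ‖ w + total Γ v
    typed-weight (cut Γ⊎Δ d e) h =
      s≤s (+-mono-⊎ Γ⊎Δ (typed-weightᵗ d h) (typed-weightᵗ e h))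
    typed-weight {c = c} {w = w} {w′} {v} (conv {Γ = Γ} i _ _ d) h =
      subst (λ n → ‖ c ‖ w′ ≤ ‖ c ‖ w + n) (total-▸-irrelevant Γ i v) (typed-weight d h)
    typed-weight {c = c} {w = w} {v = v} (weak {Γ = Γ} i _ _ d) h =
      ≤-trans (typed-weight d h) (+-monoʳ-≤ (‖ c ‖ w) (total≤total-▸ Γ i v))

  typed-once : {c : Cmd (p ∷ Θ)} {A : Con Ξ} {Γ : Ctx Ξ Θ} → c ∶⊢ just A ∷ Γ → AtMostOnce c
  typed-once {c = c} {Γ = Γ} d w n = begin
    -- Only the bound variable is raised, whence `v = 𝟘 ▹ n`.
    ‖ c ‖ (w ▹ n)                        ≤⟨ typed-weight {v = 𝟘 ▹ n} d (▹-mono ≤-refl (λ _ → m≤m+n _ 0)) ⟩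
    ‖ c ‖ (w ▹ 0) + (n + total Γ 𝟘)      ≡⟨ cong (λ k → ‖ c ‖ (w ▹ 0) + (n + k)) (total-𝟘 Γ) ⟩
    ‖ c ‖ (w ▹ 0) + (n + 0)              ≡⟨ cong (‖ c ‖ (w ▹ 0) +_) (+-identityʳ n) ⟩
    ‖ c ‖ (w ▹ 0) + n                    ∎
    where open ≤-Reasoning

  typed-once₂ : {c : Cmd (p ∷ q ∷ Θ)} {A B : Con Ξ} {Γ : Ctx Ξ Θ} →
                c ∶⊢ just A ∷ just B ∷ Γ → AtMostOnce₂ c
  typed-once₂ {c = c} {Γ = Γ} d w m n = begin
    ‖ c ‖ (w ▹ n ▹ m)
      ≤⟨ typed-weight {v = 𝟘 ▹ n ▹ m} d (▹-mono ≤-refl (▹-mono ≤-refl (λ _ → m≤m+n _ 0))) ⟩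
    ‖ c ‖ (w ▹ 0 ▹ 0) + (m + (n + total Γ 𝟘))
      ≡⟨ cong (λ k → ‖ c ‖ (w ▹ 0 ▹ 0) + (m + (n + k))) (total-𝟘 Γ) ⟩
    ‖ c ‖ (w ▹ 0 ▹ 0) + (m + (n + 0))
      ≡⟨ cong (λ k → ‖ c ‖ (w ▹ 0 ▹ 0) + (m + k)) (+-identityʳ n) ⟩
    ‖ c ‖ (w ▹ 0 ▹ 0) + (m + n)
      ∎
    where open ≤-Reasoning

  mutual

    typed-affineᵗ : {t : Term Θ p} {A : Con Ξ} {Γ : Ctx Ξ Θ} → ⊢ t ∶ A ∣ Γ → Affineᵗ t
    typed-affineᵗ (ax i _)     = tt
    typed-affineᵗ (μ₊ d)       = typed-once d , typed-affine d
    typed-affineᵗ (μ₋ d)       = typed-once d , typed-affine d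
    typed-affineᵗ (⊗I _ d e)   = typed-affineᵗ d , typed-affineᵗ e
    typed-affineᵗ (⅋I d)       = typed-once₂ d , typed-affine d
    typed-affineᵗ (↓I d)       = typed-affineᵗ d
    typed-affineᵗ (↑I d)       = typed-once d , typed-affine d
    typed-affineᵗ (∃I _ _ d)   = typed-affineᵗ d
    typed-affineᵗ (∀I d)       = typed-affineᵗ d

    typed-affine : {c : Cmd Θ} {Γ : Ctx Ξ Θ} → c ∶⊢ Γ → Affine c
    typed-affine (cut _ d e)    = typed-affineᵗ d , typed-affineᵗ e
    typed-affine (conv _ _ _ d) = typed-affine d
    typed-affine (weak _ _ _ d) = typed-affine d

  -- Reduction lowers the weight and preserves affinity.

  ,ˢ-weight : {s : Sub Θ Θ′} {V : Val Θ′ q} {w : Weight Θ} {w′ : Weight Θ′} →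
              (∀ {p} (i : p ∈ Θ) → ‖ s i ‖ᵛ w′ ≡ w i) →
              ∀ {p} (i : p ∈ q ∷ Θ) → ‖ (s ,ˢ V) i ‖ᵛ w′ ≡ (w ▹ ‖ V ‖ᵛ w′) i
  ,ˢ-weight h (here refl) = refl
  ,ˢ-weight h (there i)   = h i

  -- Affinity keeps the cuts of `V` from being duplicated. The inequality can be strict, since `V`
  -- is erased when the variable does not occur.
  []-weight : (c : Cmd (p ∷ Θ)) (V : Val Θ p) → AtMostOnce c → (w : Weight Θ) →
              ‖ c [ V ] ‖ w ≤ ‖ c ‖ (w ▹ 0) + ‖ V ‖ᵛ w
  []-weight c V once w =
    ≤-trans (≤-reflexive (sub-weight c (,ˢ-weight (λ _ → refl)))) (once w (‖ V ‖ᵛ w))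

  []-weight₂ : (c : Cmd (p ∷ q ∷ Θ)) (V : Val Θ p) (W : Val Θ q) → AtMostOnce₂ c →
               (w : Weight Θ) →
               ‖ sub (var ,ˢ W ,ˢ V) c ‖ w ≤ ‖ c ‖ (w ▹ 0 ▹ 0) + (‖ V ‖ᵛ w + ‖ W ‖ᵛ w)
  []-weight₂ c V W once w =
    ≤-trans (≤-reflexive (sub-weight c (,ˢ-weight (,ˢ-weight (λ _ → refl)))))
      (once w (‖ V ‖ᵛ w) (‖ W ‖ᵛ w))

  []-weight-comm : (c : Cmd (p ∷ Θ)) (V : Val Θ p) → AtMostOnce c → (w : Weight Θ) →
                   ‖ c [ V ] ‖ w ≤ ‖ V ‖ᵛ w + ‖ c ‖ (w ▹ 0)
  []-weight-comm c V once w =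
    ≤-trans ([]-weight c V once w) (≤-reflexive (+-comm (‖ c ‖ (w ▹ 0)) _))

  -- A redex weighs 1 for its own cut plus the weights of its values and of the body; boxes and
  -- pairs add nothing themselves. The reduct weighs at most the same sum without the 1.
  step-weight : {c c′ : Cmd Θ} → Affine c → c ⟶₀ c′ → (w : Weight Θ) → ‖ c′ ‖ w < ‖ c ‖ w
  step-weight (_ , once , _) (inj₁ (β↓ {c = c} {V})) w = s≤s ([]-weight-comm c V once w)
  step-weight (_ , once , _) (inj₁ (β⊗ {c = c} {V} {W})) w =
    s≤s (≤-trans ([]-weight₂ c V W once w) (≤-reflexive (+-comm (‖ c ‖ (w ▹ 0 ▹ 0)) _)))
  step-weight ((once , _) , _) (inj₂ (μ₊ {c} {V})) w = s≤s ([]-weight c V once w)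
  step-weight (_ , once , _) (inj₂ (μ₋ {c} {V})) w = s≤s ([]-weight-comm c V once w)

  step-affine : {c c′ : Cmd Θ} → Affine c → c ⟶₀ c′ → Affine c′
  step-affine (a , _ , b) (inj₁ (β↓ {c = c})) =
    sub-affine c (,ˢ-affine (λ _ → tt) a) b
  step-affine ((a , a′) , _ , b) (inj₁ (β⊗ {c = c})) =
    sub-affine c (,ˢ-affine (,ˢ-affine (λ _ → tt) a′) a) b
  step-affine ((_ , a) , b) (inj₂ (μ₊ {c})) = sub-affine c (,ˢ-affine (λ _ → tt) b) a
  step-affine (a , _ , b) (inj₂ (μ₋ {c})) = sub-affine c (,ˢ-affine (λ _ → tt) a) b

  -- Normalization of affine commands.

  reducible? : (c : Cmd Θ) → Dec (∃[ c′ ] c ⟶₀ c′)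
  -- Every negative term is a value, so `μ₊` always fires, even against `μ₋`.
  reducible? ⟨ μ₊ c ∣ val V ⟩                     = yes (_ , inj₂ μ₊)
  reducible? ⟨ val V ∣ val (μ₋ c) ⟩               = yes (_ , inj₂ μ₋)
  reducible? ⟨ val V ∣ val (var i) ⟩              = no λ { (_ , inj₁ ()) ; (_ , inj₂ ()) }
  reducible? ⟨ val V ∣ val (const k) ⟩            = no λ { (_ , inj₁ ()) ; (_ , inj₂ ()) }
  reducible? ⟨ val (var i) ∣ val (μpair p q c) ⟩  = no λ { (_ , inj₁ ()) ; (_ , inj₂ ()) }
  reducible? ⟨ val (const k) ∣ val (μpair p q c) ⟩ = no λ { (_ , inj₁ ()) ; (_ , inj₂ ()) }
  reducible? ⟨ val (box V) ∣ val (μpair p q c) ⟩  = no λ { (_ , inj₁ ()) ; (_ , inj₂ ()) }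
  -- Affine commands may be ill-typed, so the polarities can clash; such a command is normal.
  reducible? ⟨ val (pair {p′} {q′} V W) ∣ val (μpair p q c) ⟩ with p′ Sign.≟ p | q′ Sign.≟ q
  ... | yes refl | yes refl = yes (_ , inj₁ β⊗)
  ... | no p′≢p  | _        = no λ { (_ , inj₁ β⊗) → p′≢p refl ; (_ , inj₂ ()) }
  ... | yes _    | no q′≢q  = no λ { (_ , inj₁ β⊗) → q′≢q refl ; (_ , inj₂ ()) }
  reducible? ⟨ val (var i) ∣ val (μbox p c) ⟩     = no λ { (_ , inj₁ ()) ; (_ , inj₂ ()) }
  reducible? ⟨ val (const k) ∣ val (μbox p c) ⟩   = no λ { (_ , inj₁ ()) ; (_ , inj₂ ()) }
  reducible? ⟨ val (pair V W) ∣ val (μbox p c) ⟩  = no λ { (_ , inj₁ ()) ; (_ , inj₂ ()) }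
  reducible? ⟨ val (box {p′} V) ∣ val (μbox p c) ⟩ with p′ Sign.≟ p
  ... | yes refl = yes (_ , inj₁ β↓)
  ... | no p′≢p  = no λ { (_ , inj₁ β↓) → p′≢p refl ; (_ , inj₂ ()) }

  -- By induction on `n`, which pays for the steps of both kinds.
  affine-normalizes : (n : ℕ) (c : Cmd Θ) → Affine c → ‖ c ‖ 𝟘 ≤ n → NormalizesWithin n c
  affine-normalizes n c a c≤n with reducible? c
  ... | no irreducible = c , ε , irreducible , z≤n
  -- Every command is itself a cut, so its weight is positive.
  affine-normalizes zero    ⟨ _ ∣ _ ⟩ a () | yes _
  affine-normalizes (suc n) c a c≤n | yes (c′ , r)
    with affine-normalizes n c′ (step-affine a r)
           (s≤s⁻¹ (≤-trans (step-weight a r 𝟘) c≤n))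
  affine-normalizes (suc n) c a c≤n | yes (c′ , inj₁ r) | d , rs , nf , #β≤n =
    d , inj₁ r ◅ rs , nf , s≤s #β≤n
  affine-normalizes (suc n) c a c≤n | yes (c′ , inj₂ r) | d , rs , nf , #β≤n =
    -- A μ-step also uses up a unit of weight, though `#β` does not count it.
    d , inj₂ r ◅ rs , nf , m≤n⇒m≤1+n #β≤n

theorem56 : (𝒦 : Polarity → Set) → let open Calculus 𝒦 in
    (Ξ : List Kind) (Θ : List Polarity) (Γ : Ctx Ξ Θ) (c : Cmd Θ) →
    c ∶⊢ Γ → NormalizesWithin ∣ c ∣ c
theorem56 𝒦 Ξ Θ Γ c d =
  -- With free variables weighing 0, the initial weight is the number of cuts.
  affine-normalizes 𝒦 _ c (typed-affine 𝒦 d) (weight≤size 𝒦 c (λ _ → z≤n))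
  where open Calculus 𝒦
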